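{- The generating function $$G_{(123,132)}(x,p,q,y,z)=\sum_{n\ge 0}\ \sum_{\pi\in S_n(123,132)} x^n p^{\operatorname{asc}(\pi)} q^{\operatorname{des}(\pi)} y^{\operatorname{MNA}(\pi)} z^{\operatorname{MND}(\pi)}$$ is equal to $$\frac{A}{1 - 2 q^2 x^2 z - p q x^2 y z - 2 p q^2 x^3 y z + q^4 x^4 z^2 - p q^3 x^4 y z^2},$$ where $$A=1 + x + p x^2 y + q x^2 z - 2 q^2 x^2 z - q^2 x^3 z - p q x^2 y z + 2 p q x^3 y z - 2 p q^2 x^3 y z - q^3 x^4 z^2 + q^4 x^4 z^2 + p q^2 x^4 y z^2 - p q^3 x^4 y z^2.$$
   Context: For $n\ge 0$, $S_n$ denotes the set of permutations $\pi=\pi_1\pi_2\cdots\pi_n$ of $[n]=\{1,\dots,n\}$ in one-line notation ($S_0$ consists of the empty permutation, for which all statistics below are $0$). A permutation $\pi\in S_n$ avoids a pattern $\tau\in S_k$ if there are no indices $i_1<\dots<i_k$ such that $\pi_{i_a}<\pi_{i_b}$ if and only if $\tau_a<\tau_b$; $S_n(\tau,\rho)$ is the set of permutations in $S_n$ avoiding both $\tau$ and $\rho$. $\operatorname{asc}(\pi)$ (resp. $\operatorname{des}(\pi)$) is the number of $i\in[n-1]$ with $\pi_i<\pi_{i+1}$ (resp. $\pi_i>\pi_{i+1}$). $\operatorname{MNA}(\pi)$ is the maximum size of a set $I\subseteq[n-1]$ such that $\pi_i<\pi_{i+1}$ for all $i\in I$ and $|i-j|\ge 2$ for distinct $i,j\in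 I$ (maximum number of non-overlapping ascents); $\operatorname{MND}(\pi)$ is defined analogously with $\pi_i>\pi_{i+1}$ (maximum number of non-overlapping descents). -}

module Defs where

open import Algebra.Bundles using (RawRing)
open import Algebra.Definitions.RawMonoid using (sum)
import Algebra.Definitions.RawSemiring as RawSemiringDefs
open import Data.Fin.Base using (Fin; zero; suc; toℕ; inject₁; _<_; _>_)
open import Data.Fin.Patterns using (0F; 1F; 2F)
open import Data.Fin.Properties using (_≟_; _<?_; all?)
open import Data.Fin.Subset using (Subset; inside; outside; _∈_; ∣_∣)
open import Data.Fin.Subset.Properties using (_∈?_)
import Data.Integer.Base as ℤ
open import Data.List.Base as List
  using (List; allFin; cartesianProductWith; filter; foldr; length)
open import Data.List.Extrema.Nat using (max)
open import Data.List.Membership.Propositional.Properties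
  using (∈-allFin; ∈-cartesianProductWith⁺)
open import Data.List.Relation.Unary.Any as Any using (here)
import Data.List.Membership.Propositional as Membership
open import Data.Nat.Base as ℕ using (ℕ; zero; suc; pred; _∸_; ∣_-_∣)
import Data.Nat.Properties as ℕ
open import Data.Product.Base using (∃; _×_; _,_)
open import Data.Vec.Base using (Vec; []; _∷_; lookup)
open import Data.Vec.Relation.Unary.AllPairs using (AllPairs; allPairs?)
open import Level using (0ℓ)
open import Relation.Binary.Core using (Rel)
open import Relation.Binary.Definitions using (Decidable)
open import Relation.Binary.PropositionalEquality using (_≢_; refl)
open import Relation.Nullary.Decidable
  using (Dec; map′; ¬?; _×-dec_; _→-dec_)
open import Relation.Nullary.Negation using (¬_)
import Relation.Unary as U

private
  variable
    k l n : ℕ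

module _ {A : Set} where

  words : List A → ∀ k → List (Vec A k)
  words as zero    = [] List.∷ List.[]
  words as (suc k) = cartesianProductWith _∷_ as (words as k)

  words-complete : ∀ {as} → (∀ a → a Membership.∈ as) →
                   (w : Vec A k) → w Membership.∈ words as k
  words-complete all∈ []      = here refl
  words-complete all∈ (a ∷ w) =
    ∈-cartesianProductWith⁺ _∷_ (all∈ a) (words-complete all∈ w)

-- One-line notation with positions and values both numbered from 0, so
-- that π_{i+1} = 1 + toℕ (lookup π i).

Word : ℕ → Set
Word n = Vec (Fin n) n

-- An injective self-map of Fin n is a permutation.

permutations : ∀ n → List (Word n)
permutations n =
  filter (allPairs? λ i j → ¬? (i ≟ j)) (words (allFin n) n)

Occurrence : Word k → Word n → Vec (Fin n) k → Set
Occurrence τ π is =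
  AllPairs _<_ is ×
  (∀ a b →
    (lookup π (lookup is a) < lookup π (lookup is b) → lookup τ a < lookup τ b) ×
    (lookup τ a < lookup τ b → lookup π (lookup is a) < lookup π (lookup is b)))

Contains Avoids : Word k → Word n → Set
Contains τ π = ∃ (Occurrence τ π)
Avoids   τ π = ¬ Contains τ π

occurrence? : (τ : Word k) (π : Word n) → U.Decidable (Occurrence τ π)
occurrence? τ π is =
  allPairs? _<?_ is ×-dec
  all? λ a → all? λ b →
    let π<? = lookup π (lookup is a) <? lookup π (lookup is b)
        τ<? = lookup τ a <? lookup τ b
    in (π<? →-dec τ<?) ×-dec (τ<? →-dec π<?)

contains? : (τ : Word k) (π : Word n) → Dec (Contains τ π)
contains? {k} {n} τ π =
  map′ Any.satisfied
       (λ (is , occ) → Membership.lose (words-complete ∈-allFin is) occ)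
       (Any.any? (occurrence? τ π) (words (allFin n) k))

avoids? : (τ : Word k) (π : Word n) → Dec (Avoids τ π)
avoids? τ π = ¬? (contains? τ π)

avoiders : Word k → Word l → ∀ n → List (Word n)
avoiders τ ρ n = filter (λ π → avoids? τ π ×-dec avoids? ρ π) (permutations n)

pattern-123 pattern-132 : Word 3
pattern-123 = 0F ∷ 1F ∷ 2F ∷ []
pattern-132 = 0F ∷ 2F ∷ 1F ∷ []

module Steps {m} {_~_ : Rel (Fin m) 0ℓ} (_~?_ : Decidable _~_) where

  Step : Vec (Fin m) n → Fin (pred n) → Set
  Step (v ∷ π) i = lookup (v ∷ π) (inject₁ i) ~ lookup π i

  step? : (π : Vec (Fin m) n) → U.Decidable (Step π)
  step? (v ∷ π) i = lookup (v ∷ π) (inject₁ i) ~? lookup π i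

  steps : Vec (Fin m) n → ℕ
  steps {n} π = length (filter (step? π) (allFin (pred n)))

  NonOverlapping : (π : Vec (Fin m) n) → Subset (pred n) → Set
  NonOverlapping π I =
    (∀ i → i ∈ I → Step π i) ×
    (∀ i j → i ∈ I → j ∈ I → i ≢ j → 2 ℕ.≤ ∣ toℕ i - toℕ j ∣)

  nonOverlapping? : (π : Vec (Fin m) n) → U.Decidable (NonOverlapping π)
  nonOverlapping? π I =
    (all? λ i → (i ∈? I) →-dec step? π i) ×-dec
    (all? λ i → all? λ j →
      (i ∈? I) →-dec ((j ∈? I) →-dec
      (¬? (i ≟ j) →-dec (2 ℕ.≤? ∣ toℕ i - toℕ j ∣))))

  -- The default value 0 is attained by the empty subset.

  maxNonOverlapping : Vec (Fin m) n → ℕ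
  maxNonOverlapping {n} π =
    max 0 (List.map ∣_∣
      (filter (nonOverlapping? π)
        (words (inside List.∷ outside List.∷ List.[]) (pred n))))

_>?_ : Decidable (_>_ {n} {n})
i >? j = j <? i

asc des MNA MND : Word n → ℕ
asc = Steps.steps _<?_
des = Steps.steps _>?_
MNA = Steps.maxNonOverlapping _<?_
MND = Steps.maxNonOverlapping _>?_

module _ (R : RawRing 0ℓ 0ℓ) where
  open RawRing R

  constant : Carrier → ℕ → Carrier
  constant c zero    = c
  constant c (suc _) = 0#

  X : ℕ → Carrier
  X 1 = 1#
  X _ = 0#

  _⟦X⟧ : RawRing 0ℓ 0ℓ
  _⟦X⟧ = record
    { Carrier = ℕ → Carrier
    ; _≈_     = λ f g → ∀ n → f n ≈ g n
    ; _+_     = λ f g n → f n + g n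
    ; _*_     = λ f g n →
                  sum +-rawMonoid {suc n} λ i → f (toℕ i) * g (n ∸ toℕ i)
    ; -_      = λ f n → - f n
    ; 0#      = λ _ → 0#
    ; 1#      = constant 1#
    }

ℤ⟦p⟧ ℤ⟦p,q⟧ ℤ⟦p,q,y⟧ ℤ⟦p,q,y,z⟧ ℤ⟦p,q,y,z,x⟧ : RawRing 0ℓ 0ℓ
ℤ⟦p⟧         = ℤ.+-*-rawRing ⟦X⟧
ℤ⟦p,q⟧       = ℤ⟦p⟧ ⟦X⟧
ℤ⟦p,q,y⟧     = ℤ⟦p,q⟧ ⟦X⟧
ℤ⟦p,q,y,z⟧   = ℤ⟦p,q,y⟧ ⟦X⟧
ℤ⟦p,q,y,z,x⟧ = ℤ⟦p,q,y,z⟧ ⟦X⟧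

module Coefficients where
  open RawRing ℤ⟦p,q,y,z⟧ public
  open RawSemiringDefs rawSemiring public using (_^_)

  p q y z : Carrier
  p = constant ℤ⟦p,q,y⟧ (constant ℤ⟦p,q⟧ (constant ℤ⟦p⟧ (X ℤ.+-*-rawRing)))
  q = constant ℤ⟦p,q,y⟧ (constant ℤ⟦p,q⟧ (X ℤ⟦p⟧))
  y = constant ℤ⟦p,q,y⟧ (X ℤ⟦p,q⟧)
  z = X ℤ⟦p,q,y⟧

  weight : Word n → Carrier
  weight π = p ^ asc π * q ^ des π * y ^ MNA π * z ^ MND π

module Series where
  open RawRing ℤ⟦p,q,y,z,x⟧ public
  open RawSemiringDefs rawSemiring public
    using (_^_) renaming (_×_ to _·_)

  infixl 6 _-_
  _-_ : Carrier → Carrier → Carrier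
  f - g = f + (- g)

  p q y z x : Carrier
  p = constant ℤ⟦p,q,y,z⟧ Coefficients.p
  q = constant ℤ⟦p,q,y,z⟧ Coefficients.q
  y = constant ℤ⟦p,q,y,z⟧ Coefficients.y
  z = constant ℤ⟦p,q,y,z⟧ Coefficients.z
  x = X ℤ⟦p,q,y,z⟧

  -- The coefficient of x ^ n is the sum of the weights over S_n(τ,ρ).

  G : Word k → Word l → Carrier
  G τ ρ n = foldr C._+_ C.0# (List.map C.weight (avoiders τ ρ n))
    where module C = Coefficients

  numerator denominator : Carrier

  numerator =
      1# + x + p * x ^ 2 * y + q * x ^ 2 * z - 2 · q ^ 2 * x ^ 2 * z
    - q ^ 2 * x ^ 3 * z - p * q * x ^ 2 * y * z + 2 · p * q * x ^ 3 * y * z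
    - 2 · p * q ^ 2 * x ^ 3 * y * z - q ^ 3 * x ^ 4 * z ^ 2
    + q ^ 4 * x ^ 4 * z ^ 2 + p * q ^ 2 * x ^ 4 * y * z ^ 2
    - p * q ^ 3 * x ^ 4 * y * z ^ 2

  denominator =
      1# - 2 · q ^ 2 * x ^ 2 * z - p * q * x ^ 2 * y * z
    - 2 · p * q ^ 2 * x ^ 3 * y * z + q ^ 4 * x ^ 4 * z ^ 2
    - p * q ^ 3 * x ^ 4 * y * z ^ 2

{-# OPTIONS --safe #-}
module Submission where

-- In a permutation avoiding 123 and 132 every value has at most one larger
-- value to its right, so each value is the largest or the second largest of
-- those not yet used: such permutations are words in the letters high and
-- low. An ascent is a factor low high, hence ascents never overlap, and a
-- run of r descents contributes ⌈r/2⌉ to MND. Building words from the right,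
-- all four statistics are therefore controlled by the first letter and the
-- parity of the initial descending run. The generating series of the
-- extensions of these four states satisfy a linear system whose determinant
-- is the denominator.

open import Defs
open import Algebra.Bundles using (CommutativeRing; CommutativeMonoid; RawRing)
import Algebra.Construct.Pointwise as Pointwise
open import Algebra.Core using (Op₂)
open import Algebra.Definitions using (Invertible)
import Algebra.Definitions.RawSemiring as RawSemiringDefs
import Algebra.Properties.CommutativeSemigroup as CommutativeSemigroup
import Algebra.Properties.Ring as RingProperties
import Algebra.Properties.Semiring.Mult.TCOptimised as Mult
import Algebra.Solver.Ring as RingSolver
open import Algebra.Solver.Ring.AlmostCommutativeRing
  using (_-Raw-AlmostCommutative⟶_; fromCommutativeRing)
open import Algebra.Structures using (IsCommutativeRing)
open import Data.Bool.Base using (Bool; true; false; not; if_then_else_)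
open import Data.Empty using (⊥-elim)
open import Data.Fin.Base
  using (Fin; zero; suc; toℕ; fromℕ; inject₁; punchIn; punchOut; _<_; _>_)
open import Data.Fin.Patterns using (0F; 1F; 2F)
import Data.Fin.Properties as Fin
open import Data.Fin.Subset using (Subset; inside; outside; _∈_; _⊆_; ∣_∣)
open import Data.Fin.Subset.Properties using (drop-∷-⊆)
open import Data.Integer.Base as ℤ using (ℤ; +_; -[1+_])
import Data.Integer.Properties as ℤ
open import Data.List.Base as List using (List; allFin; filter; length)
open import Data.List.Extrema.Nat using (max≤v⁺; v≤max⁺)
import Data.List.Membership.Propositional as List
open import Data.List.Membership.Propositional.Properties
  using (∈-allFin; ∈-filter⁺; ∈-filter⁻; ∈-map⁺; ∈-map⁻)
open import Data.List.Membership.Propositional.Properties.WithK using (unique∧set⇒bag)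
import Data.List.Properties as List
open import Data.List.Relation.Binary.BagAndSetEquality using (∼bag⇒↭)
open import Data.List.Relation.Binary.Permutation.Propositional as ↭ using (_↭_)
import Data.List.Relation.Unary.All as ListAll
import Data.List.Relation.Unary.All.Properties as ListAll
import Data.List.Relation.Unary.AllPairs as ListAllPairs
open import Data.List.Relation.Unary.Any using (here; there)
import Data.List.Relation.Unary.Unique.Propositional as ListUnique
import Data.List.Relation.Unary.Unique.Propositional.Properties as ListUnique
open import Data.Maybe.Base as Maybe using ()
open import Data.Nat.Base as ℕ using (ℕ; zero; suc; pred; ∣_-_∣; z≤n; s≤s)
import Data.Nat.Properties as ℕ
open import Data.Product.Base using (Σ; ∃; _×_; _,_; proj₁; proj₂)
open import Data.Sum.Base using (inj₂)
open import Data.Vec.Base as Vec using (Vec; []; _∷_; head; lookup; map)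
import Data.Vec.Properties as Vec
open import Data.Vec.Relation.Unary.All as All using (All; []; _∷_)
import Data.Vec.Relation.Unary.All.Properties as All
open import Data.Vec.Relation.Unary.AllPairs using (AllPairs; []; _∷_)
open import Data.Vec.Relation.Unary.Unique.Propositional using (Unique)
import Data.Vec.Relation.Unary.Unique.Propositional.Properties as Unique
open import Function.Base using (_∘_; id)
open import Function.Bundles using (mk⇔)
open import Level using (0ℓ)
open import Relation.Binary.Core using (Rel)
open import Relation.Binary.Definitions using (Decidable; tri<; tri≈; tri>)
open import Relation.Binary.PropositionalEquality
  using (_≡_; _≢_; refl; sym; trans; cong; cong₂; subst; subst₂)
import Relation.Binary.Reasoning.Setoid as ≈-Reasoning
open import Relation.Nullary.Decidable
  using (does; yes; no; dec-true; dec-false; does-⇔; dec⇒maybe)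
open import Relation.Nullary.Negation using (¬_; contradiction)
import Relation.Unary as U

-- The unknowns of the linear system are the total weights of everything that can still be put in
-- front of a given state, not the weights of the codes in that state. Every code grows from the
-- empty one, in state `(high , true)`, so only one unknown a enters the answer, as 1 + x a: the 1
-- is the empty permutation, and the factor x accounts for the value that no letter records.
-- Quotients of power series are read as products with an inverse; the denominator has one because
-- its constant coefficient is 1. The concrete coefficients form a fourfold iterated power series
-- ring, in which normalisation is hopeless; hence the algebra is carried out over an abstract
-- commutative ring and specialised only at the very end.

private
  variable
    k m n : ℕ

-- Maximum non-overlapping sets by greedy choice

Sparse : Subset n → Set
Sparse I = ∀ i j → i ∈ I → j ∈ I → i ≢ j → 2 ℕ.≤ ∣ toℕ i - toℕ j ∣

Sparse-tail : ∀ {b} {I : Subset n} → Sparse (b ∷ I) → Sparse I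
Sparse-tail sparse i j i∈I j∈I i≢j =
  sparse (suc i) (suc j) (Vec.there i∈I) (Vec.there j∈I) (i≢j ∘ Fin.suc-injective)

greedy : Subset n → Subset n
greedy []               = []
greedy (outside ∷ s)    = outside ∷ greedy s
greedy (inside ∷ [])    = inside ∷ []
greedy (inside ∷ _ ∷ s) = inside ∷ outside ∷ greedy s

greedy⊆ : (s : Subset n) → greedy s ⊆ s
greedy⊆ (outside ∷ s)    (Vec.there i∈)             = Vec.there (greedy⊆ s i∈)
greedy⊆ (inside ∷ [])    i∈                         = i∈
greedy⊆ (inside ∷ b ∷ s) Vec.here                   = Vec.here
greedy⊆ (inside ∷ b ∷ s) (Vec.there (Vec.there i∈)) = Vec.there (Vec.there (greedy⊆ s i∈))

greedy-sparse : (s : Subset n) → Sparse (greedy s)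
greedy-sparse (outside ∷ s) (suc i) (suc j) (Vec.there i∈) (Vec.there j∈) i≢j =
  greedy-sparse s i j i∈ j∈ (i≢j ∘ cong suc)
greedy-sparse (inside ∷ []) zero zero _ _ i≢j = contradiction refl i≢j
greedy-sparse (inside ∷ _ ∷ s) zero zero _ _ i≢j = contradiction refl i≢j
greedy-sparse (inside ∷ _ ∷ s) zero (suc (suc j)) _ _ _ = s≤s (s≤s z≤n)
greedy-sparse (inside ∷ _ ∷ s) (suc (suc i)) zero _ _ _ = s≤s (s≤s z≤n)
greedy-sparse (inside ∷ _ ∷ s) (suc (suc i)) (suc (suc j))
  (Vec.there (Vec.there i∈)) (Vec.there (Vec.there j∈)) i≢j =
  greedy-sparse s i j i∈ j∈ (i≢j ∘ cong (λ l → suc (suc l)))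
greedy-sparse (inside ∷ _ ∷ s) zero (suc zero) _ (Vec.there ()) _
greedy-sparse (inside ∷ _ ∷ s) (suc zero) _ (Vec.there ()) _ _
greedy-sparse (inside ∷ _ ∷ s) (suc (suc _)) (suc zero) _ (Vec.there ()) _

-- Exchange argument: when the first position is available, a sparse set holds at most one of the
-- first two positions, the greedy set holds exactly one of them, and the remainders are compared by
-- induction.
greedy-maximum : (s I : Subset n) → I ⊆ s → Sparse I → ∣ I ∣ ℕ.≤ ∣ greedy s ∣
greedy-maximum []            []            _   _      = z≤n
greedy-maximum (outside ∷ s) (outside ∷ I) I⊆s sparse =
  greedy-maximum s I (drop-∷-⊆ I⊆s) (Sparse-tail sparse)
greedy-maximum (outside ∷ s) (inside ∷ I)  I⊆s _ with () ← I⊆s Vec.here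
greedy-maximum (inside ∷ []) (outside ∷ []) _ _ = z≤n
greedy-maximum (inside ∷ []) (inside ∷ [])  _ _ = ℕ.≤-refl
greedy-maximum (inside ∷ _ ∷ s) (inside ∷ inside ∷ I) _ sparse
  with s≤s () ← sparse 0F 1F Vec.here (Vec.there Vec.here) (λ ())
greedy-maximum (inside ∷ _ ∷ s) (inside ∷ outside ∷ I) I⊆s sparse =
  s≤s (greedy-maximum s I (drop-∷-⊆ (drop-∷-⊆ I⊆s)) (Sparse-tail (Sparse-tail sparse)))
greedy-maximum (inside ∷ _ ∷ s) (outside ∷ inside ∷ I) I⊆s sparse =
  s≤s (greedy-maximum s I (drop-∷-⊆ (drop-∷-⊆ I⊆s)) (Sparse-tail (Sparse-tail sparse)))
greedy-maximum (inside ∷ _ ∷ s) (outside ∷ outside ∷ I) I⊆s sparse =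
  ℕ.m≤n⇒m≤1+n (greedy-maximum s I (drop-∷-⊆ (drop-∷-⊆ I⊆s)) (Sparse-tail (Sparse-tail sparse)))

initialRunEven : Vec Bool n → Bool
initialRunEven []          = true
initialRunEven (false ∷ s) = true
initialRunEven (true ∷ s)  = not (initialRunEven s)

-- Prepending shifts the greedy choice along the whole initial run, but its size ⌈r/2⌉ grows exactly
-- when r is even. After two leading `true`s the greedy set restarts, which makes the parity
-- alternate.
∣greedy-true∷∣ : (s : Vec Bool n) →
  ∣ greedy (true ∷ s) ∣ ≡ (if initialRunEven s then suc ∣ greedy s ∣ else ∣ greedy s ∣)
∣greedy-true∷∣ []          = refl
∣greedy-true∷∣ (false ∷ s) = refl
∣greedy-true∷∣ (true ∷ s) rewrite ∣greedy-true∷∣ s with initialRunEven s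
... | true  = refl
... | false = refl

length-filter-tabulate : ∀ {A : Set} {P : U.Pred A 0ℓ} (P? : U.Decidable P)
  (f : Fin n → A) (s : Subset n) → (∀ i → does (P? (f i)) ≡ lookup s i) →
  length (filter P? (List.tabulate f)) ≡ ∣ s ∣
length-filter-tabulate P? f []      eq = refl
length-filter-tabulate P? f (b ∷ s) eq rewrite eq zero with b
... | true  = cong suc (length-filter-tabulate P? (f ∘ suc) s (eq ∘ suc))
... | false = length-filter-tabulate P? (f ∘ suc) s (eq ∘ suc)

-- The statistics as functions of the Boolean word of steps

module Signature {m} {_~_ : Rel (Fin m) 0ℓ} (_~?_ : Decidable _~_) where
  open Steps _~?_

  signature : Vec (Fin m) n → Subset (pred n)
  signature []          = []
  signature (v ∷ [])    = []
  signature (v ∷ u ∷ w) = does (v ~? u) ∷ signature (u ∷ w)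

  does-step? : (π : Vec (Fin m) n) (i : Fin (pred n)) →
               does (step? π i) ≡ lookup (signature π) i
  does-step? (v ∷ u ∷ w) zero    = refl
  does-step? (v ∷ u ∷ w) (suc i) = does-step? (u ∷ w) i

  steps≡ : (π : Vec (Fin m) n) → steps π ≡ ∣ signature π ∣
  steps≡ π = length-filter-tabulate (step? π) id (signature π) (does-step? π)

  step⇒∈ : (π : Vec (Fin m) n) (i : Fin (pred n)) → Step π i → i ∈ signature π
  step⇒∈ π i step =
    Vec.lookup⇒[]= i _ (trans (sym (does-step? π i)) (dec-true (step? π i) step))

  ∈⇒step : (π : Vec (Fin m) n) (i : Fin (pred n)) → i ∈ signature π → Step π i
  ∈⇒step π i i∈ with step? π i | does-step? π i
  ... | yes step | _  = step
  ... | no  _    | eq with () ← trans eq (Vec.[]=⇒lookup i∈)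

  -- The default value 0 respects every bound, and the greedy set is itself one of the enumerated
  -- subsets, so it attains the maximum.
  maxNonOverlapping≡ : (π : Vec (Fin m) n) →
                       maxNonOverlapping π ≡ ∣ greedy (signature π) ∣
  maxNonOverlapping≡ {n} π = ℕ.≤-antisym
    (max≤v⁺ z≤n (ListAll.map⁺ (ListAll.tabulate λ I∈ →
      let _ , steps , sparse = ∈-filter⁻ (nonOverlapping? π) {xs = subsets} I∈
      in greedy-maximum (signature π) _ (λ {i} → step⇒∈ π i ∘ steps i) sparse)))
    (v≤max⁺ 0 _ (inj₂ (List.lose
      (∈-map⁺ ∣_∣ (∈-filter⁺ (nonOverlapping? π)
        (words-complete bool∈ (greedy (signature π)))
        ( (λ i → ∈⇒step π i ∘ greedy⊆ (signature π))
        , greedy-sparse (signature π))))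
      ℕ.≤-refl)))
    where
    bools = inside List.∷ outside List.∷ List.[]
    subsets = words bools (pred n)
    bool∈ : ∀ b → b List.∈ bools
    bool∈ true  = here refl
    bool∈ false = there (here refl)

open Signature

-- Order properties of `punchIn`, and avoidance as thinness

punchIn-< : (v : Fin (suc n)) (x : Fin n) → toℕ x ℕ.< toℕ v → punchIn v x < v
punchIn-< (suc v) zero    _         = s≤s z≤n
punchIn-< (suc v) (suc x) (s≤s x<v) = s≤s (punchIn-< v x x<v)

punchIn-> : (v : Fin (suc n)) (x : Fin n) → toℕ v ℕ.≤ toℕ x → punchIn v x > v
punchIn-> zero    x       _         = s≤s z≤n
punchIn-> (suc v) (suc x) (s≤s v≤x) = s≤s (punchIn-> v x v≤x)

punchIn-mono-< : (v : Fin (suc n)) {x y : Fin n} → x < y → punchIn v x < punchIn v y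
punchIn-mono-< v x<y = ℕ.≰⇒> (ℕ.<⇒≱ x<y ∘ Fin.punchIn-cancel-≤ v _ _)

punchIn-cancel-< : (v : Fin (suc n)) {x y : Fin n} → punchIn v x < punchIn v y → x < y
punchIn-cancel-< v x<y = ℕ.≰⇒> (ℕ.<⇒≱ x<y ∘ Fin.punchIn-mono-≤ v _ _)

≤punchIn : (v : Fin (suc n)) (x : Fin n) → toℕ x ℕ.≤ toℕ (punchIn v x)
≤punchIn zero    x       = ℕ.n≤1+n _
≤punchIn (suc v) zero    = z≤n
≤punchIn (suc v) (suc x) = s≤s (≤punchIn v x)

-- For words with distinct letters, this is avoidance of both 123 and 132.

Thin : Vec (Fin m) n → Set
Thin π = ∀ {i j k} → i < j → j < k →
         lookup π i < lookup π j → ¬ lookup π i < lookup π k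

-- By trichotomy, a map that preserves the strict order of distinct letters also reflects it: an
-- equality or a reversed comparison in `τ` would contradict the comparison in `π`.
occurrence : (τ : Word 3) (π : Word n) (is : Vec (Fin n) 3) → Unique τ →
  AllPairs _<_ is →
  (∀ a b → lookup τ a < lookup τ b → lookup π (lookup is a) < lookup π (lookup is b)) →
  Occurrence τ π is
occurrence τ π is τ! is< mono = is< , λ a b → reflect a b , mono a b
  where
  reflect : ∀ a b → lookup π (lookup is a) < lookup π (lookup is b) →
            lookup τ a < lookup τ b
  reflect a b πa<πb with Fin.<-cmp (lookup τ a) (lookup τ b)
  ... | tri< τa<τb _ _ = τa<τb
  ... | tri≈ _ τa≡τb _ with refl ← Unique.lookup-injective τ! a b τa≡τb =
    contradiction πa<πb (Fin.<-irrefl refl)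
  ... | tri> _ _ τb<τa =
    contradiction πa<πb (Fin.<-asym {x = lookup π (lookup is b)} (mono b a τb<τa))

-- Two larger values to the right of a value complete it to 123 or to 132, according to their own
-- order.
thin : (π : Word n) → Unique π → Avoids pattern-123 π → Avoids pattern-132 π → Thin π
thin π π! ¬123 ¬132 {i} {j} {k} i<j j<k πi<πj πi<πk
  with Fin.<-cmp (lookup π j) (lookup π k)
... | tri< πj<πk _ _ = ¬123 (is , occurrence pattern-123 π is
    (((λ ()) ∷ (λ ()) ∷ []) ∷ ((λ ()) ∷ []) ∷ [] ∷ []) is< λ where
      0F 0F () ; 1F 0F () ; 2F 0F () ; 1F 1F (s≤s ()) ; 2F 1F (s≤s ()) ; 2F 2F (s≤s (s≤s ()))
      0F 1F _ → πi<πj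
      0F 2F _ → πi<πk
      1F 2F _ → πj<πk)
  where
  is = i ∷ j ∷ k ∷ []
  is< = (i<j ∷ ℕ.<-trans i<j j<k ∷ []) ∷ (j<k ∷ []) ∷ [] ∷ []
... | tri≈ _ πj≡πk _ =
  Fin.<-irrefl (Unique.lookup-injective π! j k πj≡πk) j<k
... | tri> _ _ πk<πj = ¬132 (is , occurrence pattern-132 π is
    (((λ ()) ∷ (λ ()) ∷ []) ∷ ((λ ()) ∷ []) ∷ [] ∷ []) is< λ where
      0F 0F () ; 1F 0F () ; 2F 0F () ; 1F 1F (s≤s (s≤s ())) ; 1F 2F (s≤s ()) ; 2F 2F (s≤s ())
      0F 1F _ → πi<πj
      0F 2F _ → πi<πk
      2F 1F _ → πk<πj)
  where
  is = i ∷ j ∷ k ∷ []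
  is< = (i<j ∷ ℕ.<-trans i<j j<k ∷ []) ∷ (j<k ∷ []) ∷ [] ∷ []

thin⇒avoids : (τ : Word 3) → lookup τ 0F < lookup τ 1F → lookup τ 0F < lookup τ 2F →
              (π : Word n) → Thin π → Avoids τ π
thin⇒avoids τ τ₀<τ₁ τ₀<τ₂ π π-thin
  (i ∷ j ∷ k ∷ [] , (i<j ∷ _) ∷ (j<k ∷ _) ∷ _ , iso) =
  π-thin i<j j<k (proj₂ (iso 0F 1F) τ₀<τ₁) (proj₂ (iso 0F 2F) τ₀<τ₂)

-- Coding the avoiders by words in two letters

data Letter : Set where
  high low : Letter

-- The first letter says whether the first value is the largest or the
-- second largest one, and the others encode the standardised rest; the
-- last value is forced, so that a word of length n stands for a
-- permutation of length 1 + n.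

pivot : Letter → Fin (2 ℕ.+ n)
pivot high = fromℕ _
pivot low  = inject₁ (fromℕ _)

insert : Fin (suc n) → Word n → Word (suc n)
insert v w = v ∷ map (punchIn v) w

perm : Vec Letter n → Word (suc n)
perm []      = zero ∷ []
perm (b ∷ s) = insert (pivot b) (perm s)

toℕ-low : ∀ n → toℕ (pivot {n} low) ≡ n
toℕ-low n = trans (Fin.toℕ-inject₁ (fromℕ n)) (Fin.toℕ-fromℕ n)

punchIn-low-fromℕ : ∀ n → punchIn (pivot {n} low) (fromℕ n) ≡ fromℕ (suc n)
punchIn-low-fromℕ zero    = refl
punchIn-low-fromℕ (suc n) = cong suc (punchIn-low-fromℕ n)

low≤pivot : ∀ b → n ℕ.≤ toℕ (pivot {n} b)
low≤pivot {n} high =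
  ℕ.≤-trans (ℕ.n≤1+n n) (ℕ.≤-reflexive (sym (cong suc (Fin.toℕ-fromℕ n))))
low≤pivot {n} low  = ℕ.≤-reflexive (sym (toℕ-low n))

-- Supplies one of the two larger values that `thin-head` needs. A leading `high` is the largest
-- value; inserting `low` leaves it the largest.
fromℕ∈perm : (s : Vec Letter n) → ∃ λ j → lookup (perm s) j ≡ fromℕ n
fromℕ∈perm []         = zero , refl
fromℕ∈perm (high ∷ s) = zero , refl
fromℕ∈perm {suc n} (low ∷ s) =
  let j , eq = fromℕ∈perm s in
  suc j , trans (Vec.lookup-map j _ (perm s))
                (trans (cong (punchIn _) eq) (punchIn-low-fromℕ n))

insert-unique : (v : Fin (suc n)) {w : Word n} → Unique w → Unique (insert v w)
insert-unique v {w} w! =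
  All.map⁺ (All.universal (λ x → Fin.punchInᵢ≢i v x ∘ sym) w) ∷
  Unique.map⁺ (Fin.punchIn-injective v _ _) w!

perm-unique : (s : Vec Letter n) → Unique (perm s)
perm-unique []      = [] ∷ []
perm-unique (b ∷ s) = insert-unique (pivot b) (perm-unique s)

above-pivot-unique : (b : Letter) {x y : Fin (2 ℕ.+ n)} →
                     pivot {n} b < x → pivot {n} b < y → x ≡ y
above-pivot-unique high {x} v<x v<y = contradiction v<x (ℕ.≤⇒≯ (Fin.≤fromℕ x))
above-pivot-unique {n} low {x} {y} v<x v<y = trans (top x v<x) (sym (top y v<y))
  where
  top : ∀ x → pivot {n} low < x → x ≡ fromℕ (suc n)
  top x v<x = Fin.≤-antisym (Fin.≤fromℕ x)
    (subst₂ ℕ._≤_ (cong suc (trans (toℕ-low n) (sym (Fin.toℕ-fromℕ n)))) refl v<x)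

-- At the head, two larger values would coincide by `above-pivot-unique`, against distinctness;
-- further right, `punchIn` reflects the order, so a violation would already occur in `perm s`.
perm-thin : (s : Vec Letter n) → Thin (perm s)
perm-thin [] {zero} {zero} ()
perm-thin (b ∷ s) {zero} {suc j} {suc k} _ (s≤s j<k) v<πj v<πk =
  Fin.<-irrefl (Unique.lookup-injective (perm-unique (b ∷ s)) (suc j) (suc k)
                 (above-pivot-unique b v<πj v<πk)) (s≤s j<k)
perm-thin (b ∷ s) {suc i} {suc j} {suc k} (s≤s i<j) (s≤s j<k) πi<πj πi<πk =
  perm-thin s i<j j<k (cancel i j πi<πj) (cancel i k πi<πk)
  where
  cancel : ∀ i j → lookup (perm (b ∷ s)) (suc i) < lookup (perm (b ∷ s)) (suc j) →
           lookup (perm s) i < lookup (perm s) j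
  cancel i j
    rewrite Vec.lookup-map i (punchIn (pivot b)) (perm s)
          | Vec.lookup-map j (punchIn (pivot b)) (perm s) = punchIn-cancel-< (pivot b)

insert-thin⁻ : (v : Fin (suc n)) (w : Word n) → Thin (insert v w) → Thin w
insert-thin⁻ v w v∷w-thin {i} {j} {k} i<j j<k wi<wj wi<wk =
  v∷w-thin {suc i} {suc j} {suc k} (s≤s i<j) (s≤s j<k) (shift i j wi<wj) (shift i k wi<wk)
  where
  shift : ∀ i j → lookup w i < lookup w j →
          lookup (insert v w) (suc i) < lookup (insert v w) (suc j)
  shift i j
    rewrite Vec.lookup-map i (punchIn v) w | Vec.lookup-map j (punchIn v) w = punchIn-mono-< v

unpunch : (v : Fin (suc m)) (w : Vec (Fin (suc m)) n) → All (v ≢_) w →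
          ∃ λ w′ → w ≡ map (punchIn v) w′
unpunch v []      []            = [] , refl
unpunch v (u ∷ w) (v≢u ∷ v∉w) =
  let w′ , eq = unpunch v w v∉w in
  punchOut v≢u ∷ w′ , cong₂ _∷_ (sym (Fin.punchIn-punchOut v≢u)) eq

-- The two largest values of the rest are its head `pivot b` and the image of the largest value of
-- `perm s′`. A head `v` below `pivot low` lies under both, so positions 0, 1 and 2 + j violate
-- thinness. For `s = []` there are only two possible heads.
thin-head : (v : Fin (2 ℕ.+ n)) (s : Vec Letter n) → Thin (insert v (perm s)) →
            ∃ λ b → v ≡ pivot b
thin-head zero [] _ = low , refl
thin-head (suc zero) [] _ = high , refl
thin-head {suc n} v s@(b ∷ s′) v-thin with Fin.<-cmp v (pivot low)
... | tri≈ _ v≡low _ = low , v≡low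
... | tri> _ _ low<v = high , Fin.≤-antisym (Fin.≤fromℕ v)
  (subst₂ ℕ._≤_ (cong suc (trans (toℕ-low (suc n)) (sym (Fin.toℕ-fromℕ (suc n))))) refl low<v)
... | tri< v<low _ _ =
  let j , eq = fromℕ∈perm s′ in
  ⊥-elim (v-thin {zero} {suc zero} {suc (suc j)} (s≤s z≤n) (s≤s (s≤s z≤n))
    (punchIn-> v (pivot b) (ℕ.≤-trans v≤n (low≤pivot b)))
    (subst (v <_)
      (sym (trans (Vec.lookup-map (suc j) (punchIn v) (perm s))
                  (cong (punchIn v) (Vec.lookup-map j (punchIn (pivot b)) (perm s′)))))
      (punchIn-> v _ (ℕ.≤-trans v≤n (ℕ.≤-trans
        (ℕ.≤-reflexive (sym (trans (cong toℕ eq) (Fin.toℕ-fromℕ n))))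
        (≤punchIn (pivot b) _))))))
  where
  v≤n : toℕ v ℕ.≤ n
  v≤n = ℕ.s≤s⁻¹ (subst (toℕ v ℕ.<_) (toℕ-low (suc n)) v<low)

map-unique⁻ : ∀ {A B : Set} {f : A → B} {xs : Vec A n} → Unique (map f xs) → Unique xs
map-unique⁻ {xs = []}     []           = []
map-unique⁻ {xs = x ∷ xs} (x∉xs ∷ xs!) =
  All.map (_∘ cong _) (All.map⁻ x∉xs) ∷ map-unique⁻ xs!

-- `unpunch` standardises the rest, which inherits distinctness and thinness; induction brings it to
-- the form `perm s` that `thin-head` requires.
perm-surjective : ∀ n (π : Word (suc n)) → Unique π → Thin π → ∃ λ s → π ≡ perm s
perm-surjective zero    (zero ∷ []) _ _ = [] , refl
perm-surjective (suc n) (v ∷ w) (v∉w ∷ w!) π-thin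
  with w′ , refl ← unpunch v w v∉w
  with s , refl ← perm-surjective n w′ (map-unique⁻ w!) (insert-thin⁻ v w′ π-thin)
  with b , refl ← thin-head v s π-thin = b ∷ s , refl

map-injective : ∀ {A B : Set} {f : A → B} → (∀ {x y} → f x ≡ f y → x ≡ y) →
                {xs ys : Vec A n} → map f xs ≡ map f ys → xs ≡ ys
map-injective f-inj {[]}     {[]}     _  = refl
map-injective f-inj {x ∷ xs} {y ∷ ys} eq =
  cong₂ _∷_ (f-inj (Vec.∷-injectiveˡ eq)) (map-injective f-inj (Vec.∷-injectiveʳ eq))

perm-injective : {s t : Vec Letter n} → perm s ≡ perm t → s ≡ t
perm-injective {s = []}       {[]}       _  = refl
perm-injective {s = high ∷ s} {high ∷ t} eq =
  cong (high ∷_)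
    (perm-injective (map-injective (Fin.punchIn-injective _ _ _) (Vec.∷-injectiveʳ eq)))
perm-injective {s = low ∷ s}  {low ∷ t}  eq =
  cong (low ∷_)
    (perm-injective (map-injective (Fin.punchIn-injective _ _ _) (Vec.∷-injectiveʳ eq)))
perm-injective {s = high ∷ s} {low ∷ t}  eq =
  contradiction (Vec.∷-injectiveˡ eq) Fin.fromℕ≢inject₁
perm-injective {s = low ∷ s}  {high ∷ t} eq =
  contradiction (sym (Vec.∷-injectiveˡ eq)) Fin.fromℕ≢inject₁

words-unique : ∀ {A : Set} {as : List A} → ListUnique.Unique as →
               ∀ k → ListUnique.Unique (words as k)
words-unique as! zero    = ListAll.[] ListAllPairs.∷ ListAllPairs.[]
words-unique as! (suc k) =
  ListUnique.cartesianProductWith⁺ _∷_ Vec.∷-injective as! (words-unique as! k)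

letters : List Letter
letters = high List.∷ low List.∷ List.[]

codes : ∀ n → List (Vec Letter n)
codes = words letters

codes-unique : ∀ n → ListUnique.Unique (codes n)
codes-unique = words-unique
  (((λ ()) ListAll.∷ ListAll.[]) ListAllPairs.∷ ListAll.[] ListAllPairs.∷ ListAllPairs.[])

codes-complete : (s : Vec Letter n) → s List.∈ codes n
codes-complete = words-complete λ where
  high → here refl
  low  → there (here refl)

-- Duplicate-free lists with the same members are rearrangements of each other, and a sum of weights
-- is insensitive to the order of enumeration.
avoiders↭ : ∀ n → avoiders pattern-123 pattern-132 (suc n) ↭ List.map perm (codes n)
avoiders↭ n = ∼bag⇒↭ (unique∧set⇒bag
  (ListUnique.filter⁺ _ (ListUnique.filter⁺ _
    (words-unique (ListUnique.allFin⁺ (suc n)) (suc n))))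
  (ListUnique.map⁺ perm-injective (codes-unique n))
  (mk⇔ to from))
  where
  to : ∀ {π} → π List.∈ avoiders pattern-123 pattern-132 (suc n) →
       π List.∈ List.map perm (codes n)
  to {π} π∈ =
    let π∈perms , ¬123 , ¬132 = ∈-filter⁻ _ {xs = permutations (suc n)} π∈
        _ , π! = ∈-filter⁻ _ {xs = words (allFin (suc n)) (suc n)} π∈perms
        s , π≡ = perm-surjective n π π! (thin π π! ¬123 ¬132)
    in subst (List._∈ _) (sym π≡) (∈-map⁺ perm (codes-complete s))
  from : ∀ {π} → π List.∈ List.map perm (codes n) →
         π List.∈ avoiders pattern-123 pattern-132 (suc n)
  from π∈ with s , _ , refl ← ∈-map⁻ perm π∈ =
    ∈-filter⁺ _ (∈-filter⁺ _ (words-complete ∈-allFin (perm s)) (perm-unique s))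
      ( thin⇒avoids pattern-123 (s≤s z≤n) (s≤s z≤n) (perm s) (perm-thin s)
      , thin⇒avoids pattern-132 (s≤s z≤n) (s≤s z≤n) (perm s) (perm-thin s))

-- The statistics of a coded permutation

signature-map : ∀ {k} {_~_ : Rel (Fin m) 0ℓ} {_≁_ : Rel (Fin k) 0ℓ}
  (_~?_ : Decidable _~_) (_≁?_ : Decidable _≁_) {f : Fin m → Fin k} →
  (∀ x y → does (f x ≁? f y) ≡ does (x ~? y)) →
  (w : Vec (Fin m) n) → signature _≁?_ (map f w) ≡ signature _~?_ w
signature-map _~?_ _≁?_ eq []          = refl
signature-map _~?_ _≁?_ eq (x ∷ [])    = refl
signature-map _~?_ _≁?_ eq (x ∷ y ∷ w) =
  cong₂ _∷_ (eq x y) (signature-map _~?_ _≁?_ eq (y ∷ w))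

-- The value that follows the last letter of a code is the largest one left.

first : Vec Letter n → Letter
first []      = high
first (b ∷ _) = b

descends : Letter → Letter → Bool
descends low high = false
descends _   _    = true

descents : Vec Letter n → Subset n
descents []      = []
descents (b ∷ s) = descends b (first s) ∷ descents s

ascents : Vec Letter n → Subset n
ascents s = map not (descents s)

head-perm-high : (s : Vec Letter n) → first s ≡ high → head (perm s) ≡ fromℕ n
head-perm-high []         _ = refl
head-perm-high (high ∷ s) _ = refl

second : Letter → Vec Letter n → Fin (2 ℕ.+ n)
second {n} b s = punchIn (pivot {n} b) (head (perm s))

second<pivot : ∀ b (s : Vec Letter n) →
               descends b (first s) ≡ true → second b s < pivot {n} b
second<pivot {n} high s _ = punchIn-< (fromℕ (suc n)) (head (perm s))
  (subst (toℕ (head (perm s)) ℕ.<_) (cong suc (sym (Fin.toℕ-fromℕ n)))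
    (Fin.toℕ<n (head (perm s))))
second<pivot {suc n} low s@(low ∷ _) _ = punchIn-< (pivot {suc n} low) (head (perm s))
  (subst₂ ℕ._<_ (sym (toℕ-low n)) (sym (toℕ-low (suc n))) ℕ.≤-refl)

pivot<second : ∀ b (s : Vec Letter n) →
               descends b (first s) ≡ false → pivot {n} b < second b s
pivot<second {n} low s _ with first s in eq
... | high = punchIn-> (pivot {n} low) (head (perm s)) (ℕ.≤-reflexive
  (trans (toℕ-low n) (sym (trans (cong toℕ (head-perm-high s eq)) (Fin.toℕ-fromℕ n)))))

does-descent : ∀ b (s : Vec Letter n) →
               does (pivot {n} b >? second b s) ≡ descends b (first s)
does-descent {n} b s with descends b (first s) in eq
... | true  = dec-true  (pivot {n} b >? second b s) (second<pivot b s eq)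
... | false = dec-false (pivot {n} b >? second b s) (ℕ.<⇒≯ (pivot<second b s eq))

does-ascent : ∀ b (s : Vec Letter n) →
              does (pivot {n} b Fin.<? second b s) ≡ not (descends b (first s))
does-ascent {n} b s with descends b (first s) in eq
... | true  = dec-false (pivot {n} b Fin.<? second b s) (ℕ.<⇒≯ (second<pivot b s eq))
... | false = dec-true  (pivot {n} b Fin.<? second b s) (pivot<second b s eq)

signature-insert : ∀ {_~_ : ∀ {n} → Rel (Fin n) 0ℓ} (_~?_ : ∀ {n} → Decidable (_~_ {n}))
  (v : Fin (2 ℕ.+ n)) (w : Word (suc n)) →
  (∀ x y → does (punchIn v x ~? punchIn v y) ≡ does (x ~? y)) →
  signature _~?_ (insert v w) ≡ does (v ~? punchIn v (head w)) ∷ signature _~?_ w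
signature-insert _~?_ v w@(_ ∷ _) eq = cong (_ ∷_) (signature-map _~?_ _~?_ eq w)

does-punchIn-<? : ∀ (v : Fin (suc n)) x y →
                  does (punchIn v x Fin.<? punchIn v y) ≡ does (x Fin.<? y)
does-punchIn-<? v x y =
  does-⇔ (mk⇔ (punchIn-cancel-< v) (punchIn-mono-< v))
         (punchIn v x Fin.<? punchIn v y) (x Fin.<? y)

signature-descents : (s : Vec Letter n) → signature _>?_ (perm s) ≡ descents s
signature-descents []      = refl
signature-descents (b ∷ s) = trans
  (signature-insert _>?_ (pivot b) (perm s) (λ x y → does-punchIn-<? (pivot b) y x))
  (cong₂ _∷_ (does-descent b s) (signature-descents s))

signature-ascents : (s : Vec Letter n) → signature Fin._<?_ (perm s) ≡ ascents s
signature-ascents []      = refl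
signature-ascents (b ∷ s) = trans
  (signature-insert Fin._<?_ (pivot b) (perm s) (does-punchIn-<? (pivot b)))
  (cong₂ _∷_ (does-ascent b s) (signature-ascents s))

asc-perm : (s : Vec Letter n) → asc (perm s) ≡ ∣ ascents s ∣
asc-perm s = trans (steps≡ Fin._<?_ (perm s)) (cong ∣_∣ (signature-ascents s))

des-perm : (s : Vec Letter n) → des (perm s) ≡ ∣ descents s ∣
des-perm s = trans (steps≡ _>?_ (perm s)) (cong ∣_∣ (signature-descents s))

MNA-perm : (s : Vec Letter n) → MNA (perm s) ≡ ∣ greedy (ascents s) ∣
MNA-perm s =
  trans (maxNonOverlapping≡ Fin._<?_ (perm s)) (cong (∣_∣ ∘ greedy) (signature-ascents s))

MND-perm : (s : Vec Letter n) → MND (perm s) ≡ ∣ greedy (descents s) ∣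
MND-perm s =
  trans (maxNonOverlapping≡ _>?_ (perm s)) (cong (∣_∣ ∘ greedy) (signature-descents s))

-- A code that starts with `high` is empty or starts with a descent, so an ascent put in front of it
-- touches no other ascent.
greedy-ascents : (s : Vec Letter n) → first s ≡ high →
                 ∣ greedy (true ∷ ascents s) ∣ ≡ suc ∣ greedy (ascents s) ∣
greedy-ascents []         _ = refl
greedy-ascents (high ∷ s) _ = refl

ascent⇒high : ∀ b c → descends b c ≡ false → c ≡ high
ascent⇒high low high _ = refl

-- Formal power series over a commutative ring

module PowerSeries (R : CommutativeRing 0ℓ 0ℓ) where
  private
    module R = CommutativeRing R
  open RawRing (R.rawRing ⟦X⟧)
  open CommutativeSemigroup (CommutativeMonoid.commutativeSemigroup R.+-commutativeMonoid)
    using (interchange)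
  open ≈-Reasoning R.setoid

  -- Convolution satisfies `(f * g) (suc n) = f 0 * g (suc n) + (tail f * g) n` by computation, so
  -- the ring laws follow by induction on the degree with `f` general.
  tail : Carrier → Carrier
  tail f = f ∘ suc

  -- Stated up to a degree because the approximants of the geometric series agree only that far.
  *-agree : ∀ {f f′ g g′} n → (∀ i → i ℕ.≤ n → f i R.≈ f′ i) →
            (∀ i → i ℕ.≤ n → g i R.≈ g′ i) → (f * g) n R.≈ (f′ * g′) n
  *-agree zero f≈ g≈ = R.+-congʳ (R.*-cong (f≈ 0 z≤n) (g≈ 0 z≤n))
  *-agree (suc n) f≈ g≈ =
    R.+-cong (R.*-cong (f≈ 0 z≤n) (g≈ (suc n) ℕ.≤-refl))
             (*-agree n (λ i i≤n → f≈ (suc i) (s≤s i≤n))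
                        (λ i i≤n → g≈ i (ℕ.m≤n⇒m≤1+n i≤n)))

  *-cong : ∀ {f f′ g g′} → f ≈ f′ → g ≈ g′ → f * g ≈ f′ * g′
  *-cong f≈ g≈ n = *-agree n (λ i _ → f≈ i) (λ i _ → g≈ i)

  zero-* : ∀ f → 0# * f ≈ 0#
  zero-* f zero    = R.trans (R.+-congʳ (R.zeroˡ _)) (R.+-identityˡ _)
  zero-* f (suc n) = R.trans (R.+-cong (R.zeroˡ _) (zero-* f n)) (R.+-identityˡ _)

  constant-* : ∀ c f n → (constant R.rawRing c * f) n R.≈ c R.* f n
  constant-* c f zero    = R.+-identityʳ _
  constant-* c f (suc n) = begin
    c R.* f (suc n) R.+ (0# * f) n  ≈⟨ R.+-congˡ (zero-* f n) ⟩
    c R.* f (suc n) R.+ R.0#        ≈⟨ R.+-identityʳ _ ⟩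
    c R.* f (suc n)                 ∎

  -- Splits off the last summand where the definition splits off the first; commutativity matches
  -- the two.
  *-unfoldʳ : ∀ f g n → (f * g) (suc n) R.≈ (f * tail g) n R.+ f (suc n) R.* g 0
  *-unfoldʳ f g zero = R.+-cong (R.sym (R.+-identityʳ _)) (R.+-identityʳ _)
  *-unfoldʳ f g (suc n) = begin
    f 0 R.* g (2 ℕ.+ n) R.+ (tail f * g) (suc n)
      ≈⟨ R.+-congˡ (*-unfoldʳ (tail f) g n) ⟩
    f 0 R.* g (2 ℕ.+ n) R.+ ((tail f * tail g) n R.+ f (2 ℕ.+ n) R.* g 0)
      ≈⟨ R.+-assoc _ _ _ ⟨
    (f * tail g) (suc n) R.+ f (2 ℕ.+ n) R.* g 0 ∎

  *-comm : ∀ f g → f * g ≈ g * f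
  *-comm f g zero    = R.+-congʳ (R.*-comm _ _)
  *-comm f g (suc n) = begin
    f 0 R.* g (suc n) R.+ (tail f * g) n  ≈⟨ R.+-cong (R.*-comm _ _) (*-comm (tail f) g n) ⟩
    g (suc n) R.* f 0 R.+ (g * tail f) n  ≈⟨ R.+-comm _ _ ⟩
    (g * tail f) n R.+ g (suc n) R.* f 0  ≈⟨ *-unfoldʳ g f n ⟨
    (g * f) (suc n)                       ∎

  distribʳ : ∀ h f g → (f + g) * h ≈ f * h + g * h
  distribʳ h f g zero = begin
    (f 0 R.+ g 0) R.* h 0 R.+ R.0#                  ≈⟨ R.+-cong (R.distribʳ _ _ _) (R.sym (R.+-identityˡ _)) ⟩
    (f 0 R.* h 0 R.+ g 0 R.* h 0) R.+ (R.0# R.+ R.0#)  ≈⟨ interchange _ _ _ _ ⟩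
    (f * h + g * h) 0 ∎
  distribʳ h f g (suc n) = begin
    (f 0 R.+ g 0) R.* h (suc n) R.+ ((tail f + tail g) * h) n
      ≈⟨ R.+-cong (R.distribʳ _ _ _) (distribʳ h (tail f) (tail g) n) ⟩
    (f 0 R.* h (suc n) R.+ g 0 R.* h (suc n)) R.+ ((tail f * h) n R.+ (tail g * h) n)
      ≈⟨ interchange _ _ _ _ ⟩
    (f * h + g * h) (suc n) ∎

  scale : R.Carrier → Carrier → Carrier
  scale c f n = c R.* f n

  scale-* : ∀ c f g → scale c f * g ≈ scale c (f * g)
  scale-* c f g zero = begin
    (c R.* f 0) R.* g 0 R.+ R.0#  ≈⟨ R.+-identityʳ _ ⟩
    (c R.* f 0) R.* g 0           ≈⟨ R.*-assoc _ _ _ ⟩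
    c R.* (f 0 R.* g 0)           ≈⟨ R.*-congˡ (R.+-identityʳ _) ⟨
    c R.* (f * g) 0               ∎
  scale-* c f g (suc n) = begin
    (c R.* f 0) R.* g (suc n) R.+ (scale c (tail f) * g) n
      ≈⟨ R.+-cong (R.*-assoc _ _ _) (scale-* c (tail f) g n) ⟩
    c R.* (f 0 R.* g (suc n)) R.+ c R.* (tail f * g) n
      ≈⟨ R.distribˡ _ _ _ ⟨
    c R.* (f * g) (suc n) ∎

  *-assoc : ∀ f g h → (f * g) * h ≈ f * (g * h)
  *-assoc f g h zero = R.+-congʳ (begin
    (f 0 R.* g 0 R.+ R.0#) R.* h 0  ≈⟨ R.*-congʳ (R.+-identityʳ _) ⟩
    (f 0 R.* g 0) R.* h 0           ≈⟨ R.*-assoc _ _ _ ⟩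
    f 0 R.* (g 0 R.* h 0)           ≈⟨ R.*-congˡ (R.+-identityʳ _) ⟨
    f 0 R.* (g * h) 0               ∎)
  *-assoc f g h (suc n) = begin
    -- By computation, `tail (f * g)` is `scale (f 0) (tail g) + tail f * g`.
    (f 0 R.* g 0 R.+ R.0#) R.* h (suc n) R.+ ((scale (f 0) (tail g) + tail f * g) * h) n
      ≈⟨ R.+-cong (R.*-congʳ (R.+-identityʳ _)) (distribʳ h (scale (f 0) (tail g)) (tail f * g) n) ⟩
    (f 0 R.* g 0) R.* h (suc n) R.+ ((scale (f 0) (tail g) * h) n R.+ ((tail f * g) * h) n)
      ≈⟨ R.+-cong (R.*-assoc _ _ _) (R.+-cong (scale-* (f 0) (tail g) h n) (*-assoc (tail f) g h n)) ⟩
    f 0 R.* (g 0 R.* h (suc n)) R.+ (f 0 R.* (tail g * h) n R.+ (tail f * (g * h)) n)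
      ≈⟨ R.+-assoc _ _ _ ⟨
    (f 0 R.* (g 0 R.* h (suc n)) R.+ f 0 R.* (tail g * h) n) R.+ (tail f * (g * h)) n
      ≈⟨ R.+-congʳ (R.distribˡ _ _ _) ⟨
    (f * (g * h)) (suc n) ∎

  *-identityˡ : ∀ f → 1# * f ≈ f
  *-identityˡ f n = begin
    (1# * f) n                            ≈⟨ *-cong {g = f} {f} 1≈ (λ _ → R.refl) n ⟩
    (constant R.rawRing R.1# * f) n       ≈⟨ constant-* R.1# f n ⟩
    R.1# R.* f n                          ≈⟨ R.*-identityˡ _ ⟩
    f n                                   ∎
    where
    1≈ : 1# ≈ constant R.rawRing R.1#
    1≈ _ = R.refl

  isCommutativeRing : IsCommutativeRing _≈_ _+_ _*_ -_ 0# 1#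
  isCommutativeRing = record
    { isRing = record
      { +-isAbelianGroup = Pointwise.isAbelianGroup ℕ R.+-isAbelianGroup
      ; *-cong = *-cong
      ; *-assoc = *-assoc
      ; *-identity = *-identityˡ , λ f n → R.trans (*-comm f 1# n) (*-identityˡ f n)
      ; distrib =
          (λ h f g n → begin
            (h * (f + g)) n            ≈⟨ *-comm h (f + g) n ⟩
            ((f + g) * h) n            ≈⟨ distribʳ h f g n ⟩
            (f * h) n R.+ (g * h) n    ≈⟨ R.+-cong (*-comm f h n) (*-comm g h n) ⟩
            (h * f + h * g) n          ∎)
        , distribʳ
      }
    ; *-comm = *-comm
    }

  commutativeRing : CommutativeRing 0ℓ 0ℓ
  commutativeRing = record { isCommutativeRing = isCommutativeRing }

  X*-zero : ∀ f → (X R.rawRing * f) 0 R.≈ R.0#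
  X*-zero f = R.trans (R.+-identityʳ _) (R.zeroˡ _)

  X*-suc : ∀ f n → (X R.rawRing * f) (suc n) R.≈ f n
  X*-suc f n = begin
    R.0# R.* f (suc n) R.+ (tail (X R.rawRing) * f) n
      ≈⟨ R.+-cong (R.zeroˡ _) (*-cong {g = f} {f} tailX≈1 (λ _ → R.refl) n) ⟩
    R.0# R.+ (1# * f) n  ≈⟨ R.+-identityˡ _ ⟩
    (1# * f) n           ≈⟨ *-identityˡ f n ⟩
    f n                  ∎
    where
    tailX≈1 : tail (X R.rawRing) ≈ 1#
    tailX≈1 zero    = R.refl
    tailX≈1 (suc _) = R.refl

  -- The partial sum ∑ (x g)^k over k ≤ n determines the inverse of 1 - x g up to x^n.

  partialInverse : Carrier → ℕ → Carrier
  partialInverse g zero    = 1#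
  partialInverse g (suc n) = 1# + X R.rawRing * (g * partialInverse g n)

  geometric : Carrier → Carrier
  geometric g n = partialInverse g n n

  -- The factor x raises degrees by one, so each iteration settles one more coefficient for good.
  partialInverse-stable : ∀ g m n i → i ℕ.≤ m → i ℕ.≤ n →
                          partialInverse g m i R.≈ partialInverse g n i
  partialInverse-stable g zero    zero    zero _ _ = R.refl
  partialInverse-stable g zero    (suc n) zero _ _ =
    R.sym (R.trans (R.+-congˡ (X*-zero (g * partialInverse g n))) (R.+-identityʳ _))
  partialInverse-stable g (suc m) zero    zero _ _ =
    R.trans (R.+-congˡ (X*-zero (g * partialInverse g m))) (R.+-identityʳ _)
  partialInverse-stable g (suc m) (suc n) zero _ _ = R.+-congˡ (R.trans
    (X*-zero (g * partialInverse g m)) (R.sym (X*-zero (g * partialInverse g n))))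
  partialInverse-stable g (suc m) (suc n) (suc i) (s≤s i≤m) (s≤s i≤n) = R.+-congˡ (begin
    (X R.rawRing * (g * partialInverse g m)) (suc i)  ≈⟨ X*-suc (g * partialInverse g m) i ⟩
    (g * partialInverse g m) i
      ≈⟨ *-agree {g} {g} i (λ _ _ → R.refl) (λ j j≤i →
           partialInverse-stable g m n j (ℕ.≤-trans j≤i i≤m) (ℕ.≤-trans j≤i i≤n)) ⟩
    (g * partialInverse g n) i                        ≈⟨ X*-suc (g * partialInverse g n) i ⟨
    (X R.rawRing * (g * partialInverse g n)) (suc i)  ∎)

  geometric-fixpoint : ∀ g → geometric g ≈ 1# + X R.rawRing * (g * geometric g)
  geometric-fixpoint g zero =
    R.sym (R.trans (R.+-congˡ (X*-zero (g * geometric g))) (R.+-identityʳ _))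
  geometric-fixpoint g (suc n) = R.+-congˡ (begin
    (X R.rawRing * (g * partialInverse g n)) (suc n)  ≈⟨ X*-suc (g * partialInverse g n) n ⟩
    (g * partialInverse g n) n
      ≈⟨ *-agree {g} {g} n (λ _ _ → R.refl) (λ i i≤n →
           partialInverse-stable g n i i i≤n ℕ.≤-refl) ⟩
    (g * geometric g) n                               ≈⟨ X*-suc (g * geometric g) n ⟨
    (X R.rawRing * (g * geometric g)) (suc n)         ∎)

-- A ring solver with integer coefficients

module IntegerSolver (R : CommutativeRing 0ℓ 0ℓ) where
  open CommutativeRing R renaming (refl to ≈-refl; sym to ≈-sym; trans to ≈-trans)
  open Mult semiring using (1+×; ×-homo-+; ×1-homo-*) renaming (_×_ to _·_)
  open RingProperties ring
  open ≈-Reasoning setoid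

  -- Equality of power series is undecidable, so the solver collects coefficients in ℤ. With these
  -- multiples `1 · 1#` reduces to `1#`, hence `con (+ 1)` denotes `1#` itself.
  fromℤ : ℤ → Carrier
  fromℤ (+ n)    = n · 1#
  fromℤ -[1+ n ] = - (suc n · 1#)

  fromℤ-⊖ : ∀ m n → fromℤ (m ℤ.⊖ n) ≈ m · 1# - n · 1#
  fromℤ-⊖ zero    zero    = ≈-sym (-‿inverseʳ _)
  fromℤ-⊖ zero    (suc n) = ≈-sym (+-identityˡ _)
  fromℤ-⊖ (suc m) zero    = ≈-sym (≈-trans (+-congˡ -0#≈0#) (+-identityʳ _))
  fromℤ-⊖ (suc m) (suc n) = begin
    fromℤ (suc m ℤ.⊖ suc n)             ≡⟨ cong fromℤ (ℤ.[1+m]⊖[1+n]≡m⊖n m n) ⟩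
    fromℤ (m ℤ.⊖ n)                     ≈⟨ fromℤ-⊖ m n ⟩
    m · 1# - n · 1#                     ≈⟨ +-congˡ (+-identityˡ _) ⟨
    m · 1# + (0# - n · 1#)              ≈⟨ +-congˡ (+-congʳ (-‿inverseʳ 1#)) ⟨
    m · 1# + ((1# - 1#) - n · 1#)       ≈⟨ +-congˡ (+-assoc _ _ _) ⟩
    m · 1# + (1# + (- 1# - n · 1#))     ≈⟨ +-assoc _ _ _ ⟨
    (m · 1# + 1#) + (- 1# - n · 1#)
      ≈⟨ +-cong (+-comm _ _) (-‿+-comm 1# (n · 1#)) ⟩
    (1# + m · 1#) - (1# + n · 1#)       ≈⟨ +-cong (1+× m 1#) (-‿cong (1+× n 1#)) ⟨
    suc m · 1# - suc n · 1#             ∎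

  fromℤ-+ : ∀ i j → fromℤ (i ℤ.+ j) ≈ fromℤ i + fromℤ j
  fromℤ-+ (+ m)    (+ n)    = ×-homo-+ 1# m n
  fromℤ-+ (+ m)    -[1+ n ] = fromℤ-⊖ m (suc n)
  fromℤ-+ -[1+ m ] (+ n)    = ≈-trans (fromℤ-⊖ n (suc m)) (+-comm _ _)
  fromℤ-+ -[1+ m ] -[1+ n ] = begin
    - (suc (suc (m ℕ.+ n)) · 1#)        ≈⟨ -‿cong (1+× (suc (m ℕ.+ n)) 1#) ⟩
    - (1# + (suc m ℕ.+ n) · 1#)         ≈⟨ -‿cong (+-congˡ (×-homo-+ 1# (suc m) n)) ⟩
    - (1# + (suc m · 1# + n · 1#))      ≈⟨ -‿cong (+-assoc _ _ _) ⟨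
    - ((1# + suc m · 1#) + n · 1#)      ≈⟨ -‿cong (+-congʳ (+-comm _ _)) ⟩
    - ((suc m · 1# + 1#) + n · 1#)      ≈⟨ -‿cong (+-assoc _ _ _) ⟩
    - (suc m · 1# + (1# + n · 1#))      ≈⟨ -‿cong (+-congˡ (1+× n 1#)) ⟨
    - (suc m · 1# + suc n · 1#)         ≈⟨ -‿+-comm _ _ ⟨
    - (suc m · 1#) - suc n · 1#         ∎

  fromℤ-neg : ∀ i → fromℤ (ℤ.- i) ≈ - fromℤ i
  fromℤ-neg (+ zero)  = ≈-sym -0#≈0#
  fromℤ-neg (+ suc n) = ≈-refl
  fromℤ-neg -[1+ n ]  = ≈-sym (-‿involutive _)

  fromℤ-*⁺ : ∀ m j → fromℤ (+ m ℤ.* j) ≈ (m · 1#) * fromℤ j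
  fromℤ-*⁺ m (+ n) = begin
    fromℤ (+ m ℤ.* + n)     ≡⟨ cong fromℤ (ℤ.pos-* m n) ⟨
    (m ℕ.* n) · 1#          ≈⟨ ×1-homo-* m n ⟩
    (m · 1#) * (n · 1#)     ∎
  fromℤ-*⁺ m -[1+ n ] = begin
    fromℤ (+ m ℤ.* ℤ.- (+ suc n))     ≡⟨ cong fromℤ (ℤ.neg-distribʳ-* (+ m) (+ suc n)) ⟨
    fromℤ (ℤ.- (+ m ℤ.* + suc n))     ≈⟨ fromℤ-neg (+ m ℤ.* + suc n) ⟩
    - fromℤ (+ m ℤ.* + suc n)         ≈⟨ -‿cong (fromℤ-*⁺ m (+ suc n)) ⟩
    - ((m · 1#) * (suc n · 1#))       ≈⟨ -‿distribʳ-* _ _ ⟩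
    (m · 1#) * - (suc n · 1#)         ∎

  fromℤ-* : ∀ i j → fromℤ (i ℤ.* j) ≈ fromℤ i * fromℤ j
  fromℤ-* (+ m)    j = fromℤ-*⁺ m j
  fromℤ-* -[1+ m ] j = begin
    fromℤ (ℤ.- (+ suc m) ℤ.* j)       ≡⟨ cong fromℤ (ℤ.neg-distribˡ-* (+ suc m) j) ⟨
    fromℤ (ℤ.- (+ suc m ℤ.* j))       ≈⟨ fromℤ-neg (+ suc m ℤ.* j) ⟩
    - fromℤ (+ suc m ℤ.* j)           ≈⟨ -‿cong (fromℤ-*⁺ (suc m) j) ⟩
    - ((suc m · 1#) * fromℤ j)        ≈⟨ -‿distribˡ-* _ _ ⟩
    - (suc m · 1#) * fromℤ j          ∎

  fromℤ-homomorphism : ℤ.+-*-rawRing -Raw-AlmostCommutative⟶ fromCommutativeRing R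
  fromℤ-homomorphism = record
    { ⟦_⟧    = fromℤ
    ; +-homo = fromℤ-+
    ; *-homo = fromℤ-*
    ; -‿homo = fromℤ-neg
    ; 0-homo = ≈-refl
    ; 1-homo = ≈-refl
    }

  open RingSolver ℤ.+-*-rawRing (fromCommutativeRing R) fromℤ-homomorphism
    (λ i j → Maybe.map (λ i≡j → reflexive (cong fromℤ i≡j)) (dec⇒maybe (i ℤ.≟ j))) public

-- The rational function and the elimination

-- The operations are parameters, so that the same formulas can be read in
-- the solver's polynomials, in an abstract ring and in ℤ⟦p,q,y,z,x⟧.

module RationalFunction {C : Set}
  (plus minus times : Op₂ C) (power : C → ℕ → C) (multiple : ℕ → C → C) (one : C)
  (p q y z x : C) where

  numerator : C
  numerator =
    let infixl 6 _+_ _-_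
        infixl 7 _*_
        infixr 8 _^_ _·_
        _+_ = plus
        _-_ = minus
        _*_ = times
        _^_ = power
        _·_ = multiple
    in
        one + x + p * x ^ 2 * y + q * x ^ 2 * z - 2 · q ^ 2 * x ^ 2 * z
      - q ^ 2 * x ^ 3 * z - p * q * x ^ 2 * y * z + 2 · p * q * x ^ 3 * y * z
      - 2 · p * q ^ 2 * x ^ 3 * y * z - q ^ 3 * x ^ 4 * z ^ 2
      + q ^ 4 * x ^ 4 * z ^ 2 + p * q ^ 2 * x ^ 4 * y * z ^ 2
      - p * q ^ 3 * x ^ 4 * y * z ^ 2

  denominator : C
  denominator =
    let infixl 6 _+_ _-_
        infixl 7 _*_
        infixr 8 _^_ _·_
        _+_ = plus
        _-_ = minus
        _*_ = times
        _^_ = power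
        _·_ = multiple
    in
        one - 2 · q ^ 2 * x ^ 2 * z - p * q * x ^ 2 * y * z
      - 2 · p * q ^ 2 * x ^ 3 * y * z + q ^ 4 * x ^ 4 * z ^ 2
      - p * q ^ 3 * x ^ 4 * y * z ^ 2

  -- This is (1 - `denominator`) / x, the series whose product with x is summed geometrically to
  -- invert the denominator.
  excess : C
  excess =
    let infixl 6 _+_ _-_
        infixl 7 _*_
        infixr 8 _^_ _·_
        _+_ = plus
        _-_ = minus
        _*_ = times
        _^_ = power
        _·_ = multiple
    in
        2 · q ^ 2 * x * z + p * q * x * y * z
      + 2 · p * q ^ 2 * x ^ 2 * y * z - q ^ 4 * x ^ 3 * z ^ 2
      + p * q ^ 3 * x ^ 3 * y * z ^ 2

module Elimination (S : CommutativeRing 0ℓ 0ℓ) where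
  open CommutativeRing S renaming (refl to ≈-refl; trans to ≈-trans)
  open RawSemiringDefs (RawRing.rawSemiring rawRing) using (_^_) renaming (_×_ to _·_)
  open IntegerSolver S
  open ≈-Reasoning setoid

  open RationalFunction _+_ _-_ _*_ _^_ _·_ 1# public
  private
    module Polynomials {n} =
      RationalFunction {Polynomial n} _:+_ _:-_ _:*_ _:^_ _:×_ (con (+ 1))

  denominator≈ : ∀ p q y z x → denominator p q y z x ≈ 1# - x * excess p q y z x
  denominator≈ = solve 5 (λ p q y z x →
    Polynomials.denominator p q y z x := con (+ 1) :- x :* Polynomials.excess p q y z x) ≈-refl

  -- m₁ … m₄ are the cofactors that solve the linear system for a by Cramer's rule.

  certificate : ∀ p q y z x a b c d →
     let u = x * x * (q * q * z)
         m₁ = 1# - u - x * x * (p * q * y * z)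
         m₃ = x * (p * y) * (1# + x * (q * z))
         m₂ = x * (q * z) * (m₁ + m₃)
         m₄ = x * (q * z) * m₃
     in (1# + x * a) * denominator p q y z x ≈
        numerator p q y z x + x *
        (m₁ * (a - (1# + x * (q * (z * b) + p * (y * c)))) +
         m₂ * (b - (1# + x * (q * a + p * (y * c)))) +
         m₃ * (c - (1# + x * (q * (z * b) + q * (z * d)))) +
         m₄ * (d - (1# + x * (q * a + q * c))))
  certificate = solve 9 (λ p q y z x a b c d →
     let u = x :* x :* (q :* q :* z)
         m₁ = con (+ 1) :- u :- x :* x :* (p :* q :* y :* z)
         m₃ = x :* (p :* y) :* (con (+ 1) :+ x :* (q :* z))
         m₂ = x :* (q :* z) :* (m₁ :+ m₃)
         m₄ = x :* (q :* z) :* m₃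
     in (con (+ 1) :+ x :* a) :* Polynomials.denominator p q y z x :=
        Polynomials.numerator p q y z x :+ x :*
        (m₁ :* (a :- (con (+ 1) :+ x :* (q :* (z :* b) :+ p :* (y :* c)))) :+
         m₂ :* (b :- (con (+ 1) :+ x :* (q :* a :+ p :* (y :* c)))) :+
         m₃ :* (c :- (con (+ 1) :+ x :* (q :* (z :* b) :+ q :* (z :* d)))) :+
         m₄ :* (d :- (con (+ 1) :+ x :* (q :* a :+ q :* c))))) ≈-refl

  -- The multipliers in `certificate` are determined up to a common factor: m₂ and m₄ cancel b and
  -- d, the ratio of m₁ to m₃ cancels c, and a keeps the denominator as its coefficient. The
  -- hypotheses turn every bracket into zero.
  solution : ∀ p q y z x a b c d →
    a ≈ 1# + x * (q * (z * b) + p * (y * c)) →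
    b ≈ 1# + x * (q * a + p * (y * c)) →
    c ≈ 1# + x * (q * (z * b) + q * (z * d)) →
    d ≈ 1# + x * (q * a + q * c) →
    (1# + x * a) * denominator p q y z x ≈ numerator p q y z x
  solution p q y z x a b c d a≈ b≈ c≈ d≈ = begin
    (1# + x * a) * denominator p q y z x
      ≈⟨ certificate p q y z x a b c d ⟩
    numerator p q y z x + x * _
      ≈⟨ +-congˡ (*-congˡ
           (+-cong (+-cong (+-cong (vanish a≈) (vanish b≈)) (vanish c≈)) (vanish d≈))) ⟩
    numerator p q y z x + x * (0# + 0# + 0# + 0#)
      ≈⟨ solve 2 (λ n x → n :+ x :* (con (+ 0) :+ con (+ 0) :+ con (+ 0) :+ con (+ 0)) := n)
           ≈-refl _ x ⟩
    numerator p q y z x ∎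
    where
    vanish : ∀ {m e f} → e ≈ f → m * (e - f) ≈ 0#
    vanish {m} {e} {f} e≈f = begin
      m * (e - f)  ≈⟨ *-congˡ (+-congʳ e≈f) ⟩
      m * (f - f)  ≈⟨ *-congˡ (-‿inverseʳ f) ⟩
      m * 0#       ≈⟨ zeroʳ m ⟩
      0#           ∎

  fixpoint⇒inverse : ∀ x e f → f ≈ 1# + x * (e * f) → (1# - x * e) * f ≈ 1#
  fixpoint⇒inverse x e f f≈ = begin
    (1# - x * e) * f
      ≈⟨ solve 3 (λ x e f → (con (+ 1) :- x :* e) :* f := f :- x :* (e :* f)) ≈-refl x e f ⟩
    f - x * (e * f)
      ≈⟨ +-congʳ f≈ ⟩
    1# + x * (e * f) - x * (e * f)
      ≈⟨ solve 1 (λ g → con (+ 1) :+ g :- g := con (+ 1)) ≈-refl (x * (e * f)) ⟩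
    1# ∎

  quotient : ∀ g d n f → g * d ≈ n → d * f ≈ 1# →
             Σ (Invertible _≈_ 1# _*_ d) λ d⁻¹ → g ≈ n * proj₁ d⁻¹
  quotient g d n f gd≈n df≈1 = (f , ≈-trans (*-comm f d) df≈1 , df≈1) , (begin
    g            ≈⟨ *-identityʳ g ⟨
    g * 1#       ≈⟨ *-congˡ df≈1 ⟨
    g * (d * f)  ≈⟨ *-assoc g d f ⟨
    g * d * f    ≈⟨ *-congʳ gd≈n ⟩
    n * f        ∎)

  rational : ∀ p q y z x g a b c d f →
    g ≈ 1# + x * a →
    a ≈ 1# + x * (q * (z * b) + p * (y * c)) →
    b ≈ 1# + x * (q * a + p * (y * c)) →
    c ≈ 1# + x * (q * (z * b) + q * (z * d)) →
    d ≈ 1# + x * (q * a + q * c) →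
    f ≈ 1# + x * (excess p q y z x * f) →
    Σ (Invertible _≈_ 1# _*_ (denominator p q y z x)) λ denominator⁻¹ →
      g ≈ numerator p q y z x * proj₁ denominator⁻¹
  rational p q y z x g a b c d f g≈ a≈ b≈ c≈ d≈ f≈ =
    quotient g (denominator p q y z x) (numerator p q y z x) f
      (≈-trans (*-congʳ g≈) (solution p q y z x a b c d a≈ b≈ c≈ d≈))
      (≈-trans (*-congʳ (denominator≈ p q y z x))
               (fixpoint⇒inverse x (excess p q y z x) f f≈))

-- Summing weights over codes by transfer between states

State : Set
State = Letter × Bool

state : Vec Letter n → State
state s = first s , initialRunEven (descents s)

module Transfer (R : CommutativeRing 0ℓ 0ℓ) (p q y z : CommutativeRing.Carrier R) where
  open CommutativeRing R renaming (refl to ≈-refl; sym to ≈-sym; trans to ≈-trans) hiding (zero)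
  open RawSemiringDefs (RawRing.rawSemiring rawRing) using (_^_)
  open IntegerSolver R using (solve; _:=_; _:+_; _:*_)
  open ≈-Reasoning setoid

  monomial : ℕ → ℕ → ℕ → ℕ → Carrier
  monomial a b c d = p ^ a * q ^ b * y ^ c * z ^ d

  weight : Word n → Carrier
  weight π = monomial (asc π) (des π) (MNA π) (MND π)

  codeWeight : Vec Letter n → Carrier
  codeWeight s =
    monomial (∣ ascents s ∣) (∣ descents s ∣)
             (∣ greedy (ascents s) ∣) (∣ greedy (descents s) ∣)

  weight-perm : (s : Vec Letter n) → weight (perm s) ≡ codeWeight s
  weight-perm s rewrite asc-perm s | des-perm s | MNA-perm s | MND-perm s = refl

  -- An ascent in front leaves an empty initial descending run, hence the parity `true`. A descent
  -- earns z only when it lengthens an even run.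
  branch : (State → Carrier) → Letter → State → Carrier
  branch f b (c , even) =
    if descends b c
    then q * (if even then z * f (b , false) else f (b , true))
    else p * (y * f (b , true))

  transfer : (State → Carrier) → State → Carrier
  transfer f σ = branch f high σ + branch f low σ

  -- The increments of all four statistics depend only on the new letter and the old state;
  -- `greedy-ascents` and `∣greedy-true∷∣` give the two that are not immediate.
  codeWeight-∷ : (f : State → Carrier) (b : Letter) (s : Vec Letter n) →
    codeWeight (b ∷ s) * f (state (b ∷ s)) ≈ codeWeight s * branch f b (state s)
  codeWeight-∷ f b s with descends b (first s) in eq
  ... | false rewrite greedy-ascents s (ascent⇒high b (first s) eq) =
    solve 7 (λ a b c d p y f →
    ((p :* a) :* b :* (y :* c) :* d) :* f := (a :* b :* c :* d) :* (p :* (y :* f)))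
    ≈-refl _ _ _ _ p y _
  ... | true rewrite ∣greedy-true∷∣ (descents s) with initialRunEven (descents s)
  ...   | true  = solve 7 (λ a b c d q z f →
    (a :* (q :* b) :* c :* (z :* d)) :* f := (a :* b :* c :* d) :* (q :* (z :* f)))
    ≈-refl _ _ _ _ q z _
  ...   | false = solve 6 (λ a b c d q f →
    (a :* (q :* b) :* c :* d) :* f := (a :* b :* c :* d) :* (q :* f))
    ≈-refl _ _ _ _ q _

  Σ[_]_ : ∀ {A : Set} → (A → Carrier) → List A → Carrier
  Σ[ f ] xs = List.foldr _+_ 0# (List.map f xs)

  Σ-cong : ∀ {A : Set} {f g : A → Carrier} → (∀ a → f a ≈ g a) →
           ∀ xs → Σ[ f ] xs ≈ Σ[ g ] xs
  Σ-cong f≈g List.[]       = ≈-refl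
  Σ-cong f≈g (x List.∷ xs) = +-cong (f≈g x) (Σ-cong f≈g xs)

  Σ-map-++ : ∀ {A B : Set} (f : B → Carrier) (g : A → B) xs ys →
             Σ[ f ] (List.map g xs List.++ ys) ≈ Σ[ f ∘ g ] xs + Σ[ f ] ys
  Σ-map-++ f g List.[]       ys = ≈-sym (+-identityˡ _)
  Σ-map-++ f g (x List.∷ xs) ys =
    ≈-trans (+-congˡ (Σ-map-++ f g xs ys)) (≈-sym (+-assoc _ _ _))

  Σ-+ : ∀ {A : Set} (f g : A → Carrier) xs → Σ[ f ] xs + Σ[ g ] xs ≈ Σ[ (λ a → f a + g a) ] xs
  Σ-+ f g List.[]       = +-identityˡ _
  Σ-+ f g (x List.∷ xs) = ≈-trans
    (solve 4 (λ a b c d → (a :+ b) :+ (c :+ d) := (a :+ c) :+ (b :+ d)) ≈-refl _ _ _ _)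
    (+-congˡ (Σ-+ f g xs))

  Σ-↭ : ∀ {A : Set} (f : A → Carrier) {xs ys} → xs ↭ ys → Σ[ f ] xs ≈ Σ[ f ] ys
  Σ-↭ f ↭.refl         = ≈-refl
  Σ-↭ f (↭.prep x r)   = +-congˡ (Σ-↭ f r)
  Σ-↭ f (↭.swap x y r) = ≈-trans
    (solve 3 (λ a b c → a :+ (b :+ c) := b :+ (a :+ c)) ≈-refl _ _ _)
    (+-congˡ (+-congˡ (Σ-↭ f r)))
  Σ-↭ f (↭.trans r r′) = ≈-trans (Σ-↭ f r) (Σ-↭ f r′)

  -- The total weight of the ways to put k letters in front of a code in a given state.

  extensions : ℕ → State → Carrier
  extensions zero    _ = 1#
  extensions (suc k)   = transfer (extensions k)

  -- `transfer` is adjoint to prepending a letter: the leftmost letter moves from the code into the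
  -- function of the state.
  Σ-codes-suc : ∀ n (f : State → Carrier) →
    Σ[ (λ s → codeWeight s * f (state s)) ] codes (suc n) ≈
    Σ[ (λ s → codeWeight s * transfer f (state s)) ] codes n
  Σ-codes-suc n f = begin
    Σ[ g ] codes (suc n)
      ≈⟨ Σ-map-++ g (high ∷_) (codes n) _ ⟩
    Σ[ g ∘ (high ∷_) ] codes n + Σ[ g ] (List.map (low ∷_) (codes n) List.++ List.[])
      ≈⟨ +-congˡ (≈-trans (Σ-map-++ g (low ∷_) (codes n) List.[]) (+-identityʳ _)) ⟩
    Σ[ g ∘ (high ∷_) ] codes n + Σ[ g ∘ (low ∷_) ] codes n
      ≈⟨ Σ-+ (g ∘ (high ∷_)) (g ∘ (low ∷_)) (codes n) ⟩
    Σ[ (λ s → g (high ∷ s) + g (low ∷ s)) ] codes n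
      ≈⟨ Σ-cong (λ s → ≈-trans (+-cong (codeWeight-∷ f high s) (codeWeight-∷ f low s))
                               (≈-sym (distribˡ _ _ _))) (codes n) ⟩
    Σ[ (λ s → codeWeight s * transfer f (state s)) ] codes n ∎
    where
    g : ∀ {n} → Vec Letter n → Carrier
    g s = codeWeight s * f (state s)

  1⁴ : 1# * 1# * 1# * 1# ≈ 1#
  1⁴ = ≈-trans (*-identityʳ _) (≈-trans (*-identityʳ _) (*-identityʳ _))

  -- Letters are traded one by one for extension steps until only the empty code remains; the
  -- general `k` carries the steps already traded.
  Σ-codes : ∀ n k → Σ[ (λ s → codeWeight s * extensions k (state s)) ] codes n ≈
                    extensions (n ℕ.+ k) (high , true)
  Σ-codes zero k = begin
    1# * 1# * 1# * 1# * extensions k (high , true) + 0#  ≈⟨ +-identityʳ _ ⟩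
    1# * 1# * 1# * 1# * extensions k (high , true)       ≈⟨ *-congʳ 1⁴ ⟩
    1# * extensions k (high , true)                      ≈⟨ *-identityˡ _ ⟩
    extensions k (high , true)                           ∎
  Σ-codes (suc n) k = begin
    Σ[ (λ s → codeWeight s * extensions k (state s)) ] codes (suc n)
      ≈⟨ Σ-codes-suc n (extensions k) ⟩
    Σ[ (λ s → codeWeight s * extensions (suc k) (state s)) ] codes n
      ≈⟨ Σ-codes n (suc k) ⟩
    extensions (n ℕ.+ suc k) (high , true)
      ≡⟨ cong (λ l → extensions l (high , true)) (ℕ.+-suc n k) ⟩
    extensions (suc n ℕ.+ k) (high , true) ∎

  Σ-avoiders : ∀ n → Σ[ weight ] avoiders pattern-123 pattern-132 (suc n) ≈
                     extensions n (high , true)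
  Σ-avoiders n = begin
    Σ[ weight ] avoiders pattern-123 pattern-132 (suc n)  ≈⟨ Σ-↭ weight (avoiders↭ n) ⟩
    Σ[ weight ] List.map perm (codes n)
      ≡⟨ cong (List.foldr _+_ 0#) (List.map-∘ (codes n)) ⟨
    Σ[ weight ∘ perm ] codes n
      ≈⟨ Σ-cong (λ s → ≈-trans (reflexive (weight-perm s)) (≈-sym (*-identityʳ _))) (codes n) ⟩
    Σ[ (λ s → codeWeight s * extensions 0 (state s)) ] codes n
      ≈⟨ Σ-codes n 0 ⟩
    extensions (n ℕ.+ 0) (high , true)
      ≡⟨ cong (λ l → extensions l (high , true)) (ℕ.+-identityʳ n) ⟩
    extensions n (high , true) ∎

  Σ-avoiders-zero : Σ[ weight ] avoiders pattern-123 pattern-132 0 ≈ 1#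
  Σ-avoiders-zero = ≈-trans (+-identityʳ _) 1⁴

-- The generating series and the theorem

module GeneratingFunction (R : CommutativeRing 0ℓ 0ℓ)
  (p q y z : CommutativeRing.Carrier R) where
  private
    module R = CommutativeRing R
    module S = CommutativeRing (PowerSeries.commutativeRing R)
  open Transfer R p q y z
  open PowerSeries R using (X*-zero; X*-suc; constant-*; geometric; geometric-fixpoint)
  open Elimination (PowerSeries.commutativeRing R)
    using (numerator; denominator; excess; rational)

  P Q Y Z x : S.Carrier
  P = constant R.rawRing p
  Q = constant R.rawRing q
  Y = constant R.rawRing y
  Z = constant R.rawRing z
  x = X R.rawRing

  generatingFunction : S.Carrier
  generatingFunction n = Σ[ weight ] avoiders pattern-123 pattern-132 n

  series : State → S.Carrier
  series σ n = extensions n σ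

  unfold-series : ∀ f g → f 0 R.≈ R.1# → (∀ n → f (suc n) R.≈ g n) →
                  f S.≈ S.1# S.+ x S.* g
  unfold-series f g f₀≈1 f≈g zero    =
    R.trans f₀≈1 (R.sym (R.trans (R.+-congˡ (X*-zero g)) (R.+-identityʳ _)))
  unfold-series f g f₀≈1 f≈g (suc n) =
    R.trans (f≈g n) (R.sym (R.trans (R.+-identityˡ _) (X*-suc g n)))

  constant²-* : ∀ b c f n →
    (constant R.rawRing b S.* (constant R.rawRing c S.* f)) n R.≈ b R.* (c R.* f n)
  constant²-* b c f n =
    R.trans (constant-* b (constant R.rawRing c S.* f) n) (R.*-congˡ (constant-* c f n))

  generatingFunction-rational : (g : S.Carrier) → (∀ n → g n ≡ generatingFunction n) →
    Σ (Invertible S._≈_ S.1# S._*_ (denominator P Q Y Z x)) λ denominator⁻¹ →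
      g S.≈ numerator P Q Y Z x S.* proj₁ denominator⁻¹
  generatingFunction-rational g g≡ = rational P Q Y Z x g
    he ho le lo (geometric e)
    (unfold-series g he (R.trans (R.reflexive (g≡ 0)) Σ-avoiders-zero)
                       (λ n → R.trans (R.reflexive (g≡ (suc n))) (Σ-avoiders n)))
    -- Coefficient n + 1 is one `transfer` step: in front of an initial `high` with even run, `high`
    -- gives an odd run and `low` an ascent. The other three states are read off alike.
    (unfold-series he (Q S.* (Z S.* ho) S.+ P S.* (Y S.* le)) R.refl
      λ n → R.sym (R.+-cong (constant²-* q z ho n) (constant²-* p y le n)))
    (unfold-series ho (Q S.* he S.+ P S.* (Y S.* le)) R.refl
      λ n → R.sym (R.+-cong (constant-* q he n) (constant²-* p y le n)))
    (unfold-series le (Q S.* (Z S.* ho) S.+ Q S.* (Z S.* lo)) R.refl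
      λ n → R.sym (R.+-cong (constant²-* q z ho n) (constant²-* q z lo n)))
    (unfold-series lo (Q S.* he S.+ Q S.* le) R.refl
      λ n → R.sym (R.+-cong (constant-* q he n) (constant-* q le n)))
    (geometric-fixpoint e)
    where
    he ho le lo e : S.Carrier
    he = series (high , true)
    ho = series (high , false)
    le = series (low , true)
    lo = series (low , false)
    e = excess P Q Y Z x

  -- Deciding the definitional equality of two composite expressions over
  -- ℤ⟦p,q,y,z⟧ would unfold all their convolutions. The operations are
  -- therefore arguments, identified one by one by refl, so that the results
  -- can be instantiated with those of Coefficients and Series.

  Σ-presented : ∀ _+_ _*_ _^_ 0# → _+_ ≡ R._+_ → _*_ ≡ R._*_ →
    _^_ ≡ RawSemiringDefs._^_ (RawRing.rawSemiring R.rawRing) → 0# ≡ R.0# →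
    ∀ n (w : Word n → R.Carrier) →
    (∀ π → w π ≡ (((p ^ asc π) * (q ^ des π)) * (y ^ MNA π)) * (z ^ MND π)) →
    List.foldr _+_ 0# (List.map w (avoiders pattern-123 pattern-132 n)) ≡ generatingFunction n
  Σ-presented _ _ _ _ refl refl refl refl n w w≡ =
    cong (List.foldr R._+_ R.0#) (List.map-cong w≡ (avoiders pattern-123 pattern-132 n))

  rational-presented : ∀ _≈_ _+_ _-_ _*_ _^_ _·_ 1# →
    _≈_ ≡ S._≈_ → _+_ ≡ S._+_ → _-_ ≡ S._-_ → _*_ ≡ S._*_ →
    _^_ ≡ RawSemiringDefs._^_ (RawRing.rawSemiring S.rawRing) →
    _·_ ≡ RawSemiringDefs._×_ (RawRing.rawSemiring S.rawRing) → 1# ≡ S.1# →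
    ∀ p q y z x → p ≡ P → q ≡ Q → y ≡ Y → z ≡ Z → x ≡ X R.rawRing →
    ∀ g n d → (∀ k → g k ≡ generatingFunction k) →
    n ≡ RationalFunction.numerator _+_ _-_ _*_ _^_ _·_ 1# p q y z x →
    d ≡ RationalFunction.denominator _+_ _-_ _*_ _^_ _·_ 1# p q y z x →
    Σ (Invertible _≈_ 1# _*_ d) λ d⁻¹ → g ≈ (n * proj₁ d⁻¹)
  rational-presented _ _ _ _ _ _ _ refl refl refl refl refl refl refl
    _ _ _ _ _ refl refl refl refl refl g _ _ g≡ refl refl =
    generatingFunction-rational g g≡

-- Nested like `ℤ⟦p,q,y,z⟧`, so that its operations are definitionally those of `Coefficients`.
ℤ⟦p,q,y,z⟧-commutativeRing : CommutativeRing 0ℓ 0ℓ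
ℤ⟦p,q,y,z⟧-commutativeRing =
  PowerSeries.commutativeRing (PowerSeries.commutativeRing
    (PowerSeries.commutativeRing (PowerSeries.commutativeRing ℤ.+-*-commutativeRing)))

open Series using (_≈_; _*_; 1#; G; numerator; denominator)

theorem2 : Σ (Invertible _≈_ 1# _*_ denominator) λ denominator⁻¹ →
    G pattern-123 pattern-132 ≈ numerator * proj₁ denominator⁻¹
theorem2 = rational-presented _≈_ S._+_ S._-_ _*_ S._^_ S._·_ 1#
    refl refl refl refl refl refl refl
    S.p S.q S.y S.z S.x refl refl refl refl refl
    (G pattern-123 pattern-132) numerator denominator
    (λ n → Σ-presented C._+_ C._*_ C._^_ C.0# refl refl refl refl n C.weight (λ _ → refl))
    refl refl
  where
  module C = Coefficients
  module S = Series
  open GeneratingFunction ℤ⟦p,q,y,z⟧-commutativeRing C.p C.q C.y C.z
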